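{- Let $n\ge 1$ be an integer and let $k=2n+1$ (so $k>1$ is odd). Put $N=k^2+\frac{3}{2}k+\frac{1}{2}$ (equivalently $N=4n^2+7n+3$), $a=n+1$ and $b=3n+2$. Then the three-quarters digraph $TQ(N,a,b)$ has diameter $k$. In particular, for every odd $k>1$ there exists a three-quarters digraph with diameter $k$ and $k^2+\frac{3}{2}k+\frac{1}{2}$ vertices.
   Context: For integers $N\ge 2$ and $1\le a,b\le N-1$ with $\gcd(N,a,b)=1$, the three-quarters digraph $TQ(N,a,b)$ has vertex set $\mathbb{Z}_N$ (integers modulo $N$), and each vertex $i$ is joined by arcs to $i+a$ and $i+b$ (mod $N$); it is the circulant digraph with steps $a,b$, equipped with the following distance-like function. For $x,y\in\mathbb{Z}_N$, $d(x,y)$ is the minimum integer $\ell\ge 0$ such that there exist integers $m,n'\ge 0$ with $m+n'=\ell$ and $$y-x\equiv ma+n'b,\quad\text{or}\quad y-x\equiv -ma+n'b,\quad\text{or}\quad y-x\equiv ma-n'b \pmod N.$$ (The combination $-ma-n'b$ with both $m,n'>0$ is not allowed.) The function $d$ is translation invariant, $d(x,y)=d(0,y-x)$, but need not be symmetric. The diameter of $TQ(N,a,b)$ is $\max_{x,y\in\mathbb{Z}_N} d(x,y)=\max_{z\in\mathbb{Z}_N} d(0,z)$. -}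

module Defs where

open import Data.Fin.Base using (Fin; toℕ)
open import Data.Integer.Base as ℤ using (ℤ; +_)
open import Data.Integer.Divisibility using (_∣_)
open import Data.Nat.Base using (ℕ; _+_; _≤_; _<_)
open import Data.Nat.GCD using (gcd)
open import Data.Product.Base using (∃; ∃₂; _×_)
open import Data.Rational.Unnormalised.Base as ℚᵘ using (ℚᵘ; ½)
open import Data.Sum.Base using (_⊎_)
open import Relation.Binary.PropositionalEquality.Core using (_≡_)

infix 4 _≡_[mod_]

_≡_[mod_] : ℤ → ℤ → ℕ → Set
i ≡ j [mod N ] = + N ∣ (i ℤ.- j)

record IsTQ (N a b : ℕ) : Set where
  field
    2≤N : 2 ≤ N
    1≤a : 1 ≤ a
    a<N : a < N
    1≤b : 1 ≤ b
    b<N : b < N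
    gcd≡1 : gcd (gcd N a) b ≡ 1

record ThreeQuartersDigraph : Set where
  constructor TQ
  field
    N a b : ℕ
    isTQ : IsTQ N a b

  -- The residues mod N, each given by its representative in {0, …, N − 1}.
  Vertex : Set
  Vertex = Fin N

  rep : Vertex → ℤ
  rep x = + toℕ x

  Arc : Vertex → Vertex → Set
  Arc i j = (rep j ≡ rep i ℤ.+ + a [mod N ]) ⊎ (rep j ≡ rep i ℤ.+ + b [mod N ])

  -- The fourth sign pattern, − m a − n′ b, is deliberately absent, so this is
  -- neither directed nor undirected reachability along Arc.
  Reaches : Vertex → Vertex → ℕ → Set
  Reaches x y ℓ = ∃₂ λ (m n′ : ℕ) → (m + n′ ≡ ℓ) ×
    (  (rep y ℤ.- rep x ≡ + m ℤ.* + a ℤ.+ + n′ ℤ.* + b [mod N ])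
    ⊎  (rep y ℤ.- rep x ≡ ℤ.- (+ m ℤ.* + a) ℤ.+ + n′ ℤ.* + b [mod N ])
    ⊎  (rep y ℤ.- rep x ≡ + m ℤ.* + a ℤ.- + n′ ℤ.* + b [mod N ]))

  -- "d(x, y) = ℓ"
  IsDistance : Vertex → Vertex → ℕ → Set
  IsDistance x y ℓ = Reaches x y ℓ × (∀ ℓ′ → Reaches x y ℓ′ → ℓ ≤ ℓ′)

  -- D is the maximum of d; in particular d(x, y) exists for all x and y.
  HasDiameter : ℕ → Set
  HasDiameter D =
      (∀ x y → ∃ λ ℓ → IsDistance x y ℓ × ℓ ≤ D)
    × (∃₂ λ x y → IsDistance x y D)

-- Rationals, because k² + (3/2) k + 1/2 has fractional coefficients.
fromℕ : ℕ → ℚᵘ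
fromℕ n = + n ℚᵘ./ 1

order : ℕ → ℚᵘ
order k = fromℕ k ℚᵘ.* fromℕ k ℚᵘ.+ (+ 3 ℚᵘ./ 2) ℚᵘ.* fromℕ k ℚᵘ.+ ½

{-# OPTIONS --safe #-}

-- Here b = 3a − 1 and N = a (a + b), so the pairs (m, n′) with m a + n′ b ≡ 0
-- form the lattice generated by (a + b, 0) and (a, a).  Row n′ = j with
-- 0 ≤ j < a is covered exactly: the admissible pairs of length at most
-- k = 2a − 1 in that row have −(k − j) ≤ m ≤ k − j, and those in the fourth
-- quadrant of row j − a, translated by (a, a), extend this to m ≤ k + j, which
-- makes 2k + 1 = a + b consecutive values of m.  Conversely, the element k a is
-- at distance k: every element of the coset of (k, 0) has length at least k.
module Submission where

open import Defs
open import Data.Nat.Base using (ℕ; _+_; _*_; _^_; _≤_; _<_)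
open import Data.Nat.DivMod using (_%_)
open import Data.Product.Base using (Σ-syntax; ∃; _×_)
open import Data.Rational.Unnormalised.Base using (_≃_)
open import Relation.Binary.PropositionalEquality.Core using (_≡_)
open ThreeQuartersDigraph using (N; HasDiameter)

open import Data.Fin.Base using (fromℕ<)
open import Data.Fin.Properties using (toℕ-fromℕ<)
open import Data.Integer.Base as ℤ using (ℤ; +_; -[1+_]; ∣_∣)
open import Data.Integer.Divisibility.Signed using (divides; ∣⇒∣ᵤ; ∣ᵤ⇒∣)
open import Data.Integer.DivMod using (_%ℕ_; _/ℕ_; n%ℕd<d; a≡a%ℕn+[a/ℕn]*n)
import Data.Integer.Properties as ℤ
import Data.Integer.Tactic.RingSolver as ℤ
open import Data.Nat.Base using (suc; s≤s; z≤n; s≤s⁻¹; _∸_; NonZero; >-nonZero)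
open import Data.Nat.Divisibility as ℕ using (_∣?_; ∣1⇒≡1; ∣-trans; n∣m*n; ∣m+n∣m⇒∣n)
open import Data.Nat.DivMod using (_/_; m≡m%n+[m/n]*n)
open import Data.Nat.GCD using (gcd; gcd[m,n]∣m; gcd[m,n]∣n)
open import Data.Nat.Induction using (<-rec)
open import Data.Nat.Properties
open import Data.Nat.Tactic.RingSolver using (solve-∀)
open import Data.Product.Base using (_,_; ∃₂)
open import Data.Rational.Unnormalised.Base using (*≡*)
open import Data.Sum.Base using (_⊎_; inj₁; inj₂)
open import Relation.Binary.PropositionalEquality.Core using (refl; sym; trans; cong; cong₂; subst)
open import Relation.Nullary.Decidable using (Dec; yes; no; map′; _⊎-dec_)
open import Relation.Unary using (Decidable)

-- Least lengths and decidability of reachability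

least : ∀ {p} {P : ℕ → Set p} → Decidable P → ∀ m → P m →
        ∃ λ l → (P l × (∀ i → P i → l ≤ i)) × l ≤ m
least {P = P} P? = <-rec _ step
  where
  step : ∀ m → (∀ {i} → i < m → P i → _) → P m → _
  step m rec pm with anyUpTo? P? m
  ... | yes (i , i<m , pi) =
          let l , isLeast , l≤i = rec i<m pi in l , isLeast , ≤-trans l≤i (<⇒≤ i<m)
  ... | no none = m , (pm , λ i pi → ≮⇒≥ λ i<m → none (i , i<m , pi)) , ≤-refl

Congruent : (N a b : ℕ) → ℤ → ℕ → ℕ → Set
Congruent N a b z m n =
     (z ≡ + m ℤ.* + a ℤ.+ + n ℤ.* + b [mod N ])
  ⊎  (z ≡ ℤ.- (+ m ℤ.* + a) ℤ.+ + n ℤ.* + b [mod N ])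
  ⊎  (z ≡ + m ℤ.* + a ℤ.- + n ℤ.* + b [mod N ])

-- With `z` equal to `rep y ℤ.- rep x` this unfolds to `Reaches x y l`. Abstracting the difference
-- makes translation invariance automatic.
Combination : (N a b : ℕ) → ℤ → ℕ → Set
Combination N a b z l = ∃₂ λ m n → m + n ≡ l × Congruent N a b z m n

congruent? : ∀ N a b z m n → Dec (Congruent N a b z m n)
congruent? N a b z m n = (N ∣? _) ⊎-dec (N ∣? _) ⊎-dec (N ∣? _)

-- A finite search: `m` is at most `l`, and it determines the other coefficient as `l ∸ m`.
combination? : ∀ N a b z → Decidable (Combination N a b z)
combination? N a b z l = map′ to from (anyUpTo? (λ m → congruent? N a b z m (l ∸ m)) (suc l))
  where
  to : _ → Combination N a b z l
  to (m , m<1+l , c) = m , l ∸ m , m+[n∸m]≡n (s≤s⁻¹ m<1+l) , c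

  from : Combination N a b z l → _
  from (m , n , refl , c) = m , s≤s (m≤m+n m n) , subst (Congruent N a b z m) (sym (m+n∸m≡n m n)) c

-- Congruences as equations, and bounds on absolute values

congruent : ∀ {i j N} q → i ≡ j ℤ.+ q ℤ.* + N → i ≡ j [mod N ]
congruent {j = j} {N} q refl = ∣⇒∣ᵤ (divides q (cancel j (q ℤ.* + N)))
  where
  cancel : ∀ x y → x ℤ.+ y ℤ.- x ≡ y
  cancel = ℤ.solve-∀

congruent⁻¹ : ∀ {i j N} → i ≡ j [mod N ] → ∃ λ q → j ≡ i ℤ.+ q ℤ.* + N
congruent⁻¹ {i} {j} {N} c with ∣ᵤ⇒∣ c
... | divides q eq = ℤ.- q ,
        trans (swap i j) (trans (cong (λ x → i ℤ.- x) eq) (neg i q (+ N)))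
  where
  swap : ∀ x y → y ≡ x ℤ.- (x ℤ.- y)
  swap = ℤ.solve-∀
  neg : ∀ x y z → x ℤ.- y ℤ.* z ≡ x ℤ.+ (ℤ.- y) ℤ.* z
  neg = ℤ.solve-∀

-- Two nonnegative summands cannot cancel. The lower bound writes `u` as plus or minus such a sum,
-- with `q` equal to `a + b`.
≤∣⁺∣ : ∀ p s q {u} → u ≡ + p ℤ.+ + s ℤ.* + q → p ≤ ∣ u ∣
≤∣⁺∣ p s q refl rewrite sym (ℤ.pos-* s q) = m≤m+n p (s * q)

≤∣⁻∣ : ∀ p s q {u} → u ≡ ℤ.- (+ p ℤ.+ + s ℤ.* + q) → p ≤ ∣ u ∣
≤∣⁻∣ p s q refl = subst (p ≤_) (sym (ℤ.∣-i∣≡∣i∣ (+ p ℤ.+ + s ℤ.* + q))) (≤∣⁺∣ p s q refl)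

-- Parameters of the family

module Family (n : ℕ) where

  N₀ a b k : ℕ
  N₀ = 4 * n ^ 2 + 7 * n + 3
  a  = n + 1
  b  = 3 * n + 2
  k  = 2 * n + 1

  instance
    a≢0 : NonZero a
    a≢0 = >-nonZero (m≤n+m 1 n)
    a+b≢0 : NonZero (a + b)
    a+b≢0 = >-nonZero (≤-trans (m≤n+m 1 n) (m≤m+n a b))

  N₀≡a[a+b] : + N₀ ≡ + a ℤ.* (+ a ℤ.+ + b)
  N₀≡a[a+b] = trans (cong +_ (eq n)) (ℤ.pos-* a (a + b))
    where
    -- `n * (n * 1)` is what `n ^ 2` unfolds to.
    eq : ∀ n → 4 * (n * (n * 1)) + 7 * n + 3 ≡ (n + 1) * ((n + 1) + (3 * n + 2))
    eq = solve-∀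

  b≡3a-1 : + b ≡ + 3 ℤ.* + a ℤ.- + 1
  b≡3a-1 = trans (cong (ℤ._+ + 2) (ℤ.pos-* 3 n)) (eq (+ n))
    where
    eq : ∀ ν → + 3 ℤ.* ν ℤ.+ + 2 ≡ + 3 ℤ.* (ν ℤ.+ + 1) ℤ.- + 1
    eq = ℤ.solve-∀

  k≡2a-1 : + k ≡ + 2 ℤ.* + a ℤ.- + 1
  k≡2a-1 = trans (cong (ℤ._+ + 1) (ℤ.pos-* 2 n)) (eq (+ n))
    where
    eq : ∀ ν → + 2 ℤ.* ν ℤ.+ + 1 ≡ + 2 ℤ.* (ν ℤ.+ + 1) ℤ.- + 1
    eq = ℤ.solve-∀

  isTQ : IsTQ N₀ a b
  isTQ = record
    { 2≤N = subst (2 ≤_) (sym (eq₂ n)) (m≤m+n 2 _)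
    ; 1≤a = m≤n+m 1 n
    ; a<N = subst (a <_) (sym (eqa n)) (m≤m+n (suc a) _)
    ; 1≤b = ≤-trans (s≤s z≤n) (m≤n+m 2 (3 * n))
    ; b<N = subst (b <_) (sym (eqb n)) (m≤m+n (suc b) _)
    -- A common divisor of `a` and `b` divides `3 a = b + 1` as well as `b`, hence 1.
    ; gcd≡1 = ∣1⇒≡1 (∣m+n∣m⇒∣n g∣b+1 g∣b)
    }
    where
    g = gcd (gcd N₀ a) b
    g∣b : g ℕ.∣ b
    g∣b = gcd[m,n]∣n (gcd N₀ a) b
    g∣a : g ℕ.∣ a
    g∣a = ∣-trans (gcd[m,n]∣m (gcd N₀ a) b) (gcd[m,n]∣n N₀ a)
    3a : ∀ n → 3 * (n + 1) ≡ 3 * n + 2 + 1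
    3a = solve-∀
    g∣b+1 : g ℕ.∣ b + 1
    g∣b+1 = subst (g ℕ.∣_) (3a n) (∣-trans g∣a (n∣m*n 3))
    eq₂ : ∀ n → 4 * (n * (n * 1)) + 7 * n + 3 ≡ 2 + (4 * (n * n) + 7 * n + 1)
    eq₂ = solve-∀
    eqa : ∀ n → 4 * (n * (n * 1)) + 7 * n + 3 ≡ 1 + (n + 1) + (4 * (n * n) + 6 * n + 1)
    eqa = solve-∀
    eqb : ∀ n → 4 * (n * (n * 1)) + 7 * n + 3 ≡ 1 + (3 * n + 2) + (4 * (n * n) + 4 * n)
    eqb = solve-∀

  N₀≃order : fromℕ N₀ ≃ order k
  N₀≃order = *≡* (eq {A = + a} N₀≡a[a+b] b≡3a-1 k≡2a-1)
    where
    -- The cross-multiplied equation; 4 is the unreduced denominator of `order k`.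
    eq : ∀ {N A B K} → N ≡ A ℤ.* (A ℤ.+ B) → B ≡ + 3 ℤ.* A ℤ.- + 1 → K ≡ + 2 ℤ.* A ℤ.- + 1 →
         N ℤ.* + 4 ≡ ((K ℤ.* K ℤ.* + 2 ℤ.+ + 3 ℤ.* K ℤ.* + 1) ℤ.* + 2 ℤ.+ + 1 ℤ.* + 2) ℤ.* + 1
    eq {A = A} refl refl refl = identity A
      where
      identity : ∀ A → A ℤ.* (A ℤ.+ (+ 3 ℤ.* A ℤ.- + 1)) ℤ.* + 4 ≡
        (((+ 2 ℤ.* A ℤ.- + 1) ℤ.* (+ 2 ℤ.* A ℤ.- + 1) ℤ.* + 2 ℤ.+ + 3 ℤ.* (+ 2 ℤ.* A ℤ.- + 1) ℤ.* + 1)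
          ℤ.* + 2 ℤ.+ + 1 ℤ.* + 2) ℤ.* + 1
      identity = ℤ.solve-∀

  -- Upper bound: every residue has length at most k

  -- Reducing z modulo a fixes j, as b ≡ −1 (mod a). As N₀ = a (a + b), the
  -- coefficient of a matters only modulo a + b, and r selects its
  -- representative in the window [j − k, j − k + a + b).
  representation : ∀ z → ∃₂ λ j r → ∃ λ p → j ≤ n × r < a + b ×
    z ≡ (+ (r + j) ℤ.- + k) ℤ.* + a ℤ.+ + j ℤ.* + b ℤ.+ p ℤ.* + N₀
  representation z = j , r , p , j≤n , n%ℕd<d x (a + b) ,
    eq {+ a} {K = + k} {+ j} z q x (+ r) p N₀≡a[a+b] b≡3a-1 (a≡a%ℕn+[a/ℕn]*n (ℤ.- z) a) refl (a≡a%ℕn+[a/ℕn]*n x (a + b))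
    where
    j = (ℤ.- z) %ℕ a
    q = (ℤ.- z) /ℕ a
    -- Solves `(x + j − k) a + j b = z`: as `b = 3a − 1` and `z = −j − q a`, this amounts to
    -- `x + 4j − k = −q`.
    x = + k ℤ.- + 4 ℤ.* + j ℤ.- q
    r = x %ℕ (a + b)
    p = x /ℕ (a + b)
    j≤n : j ≤ n
    j≤n = s≤s⁻¹ (subst (j <_) (+-comm n 1) (n%ℕd<d (ℤ.- z) a))
    eq : ∀ {A B N K ι} z q x ρ p → N ≡ A ℤ.* (A ℤ.+ B) → B ≡ + 3 ℤ.* A ℤ.- + 1 →
         ℤ.- z ≡ ι ℤ.+ q ℤ.* A → x ≡ K ℤ.- + 4 ℤ.* ι ℤ.- q → x ≡ ρ ℤ.+ p ℤ.* (A ℤ.+ B) →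
         z ≡ (ρ ℤ.+ ι ℤ.- K) ℤ.* A ℤ.+ ι ℤ.* B ℤ.+ p ℤ.* N
    eq {A} {K = K} {ι} z q x ρ p refl refl -z≡ x≡ x≡′ =
      trans (sym (ℤ.neg-involutive z)) (trans (cong ℤ.-_ -z≡)
        (trans (expand A K ι q) (trans (cong (λ y → (y ℤ.+ ι ℤ.- K) ℤ.* A ℤ.+ ι ℤ.* (+ 3 ℤ.* A ℤ.- + 1))
          (trans (sym x≡) x≡′)) (collect A K ι ρ p))))
      where
      expand : ∀ A K ι q → ℤ.- (ι ℤ.+ q ℤ.* A) ≡
        (K ℤ.- + 4 ℤ.* ι ℤ.- q ℤ.+ ι ℤ.- K) ℤ.* A ℤ.+ ι ℤ.* (+ 3 ℤ.* A ℤ.- + 1)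
      expand = ℤ.solve-∀
      collect : ∀ A K ι ρ p →
        (ρ ℤ.+ p ℤ.* (A ℤ.+ (+ 3 ℤ.* A ℤ.- + 1)) ℤ.+ ι ℤ.- K) ℤ.* A ℤ.+ ι ℤ.* (+ 3 ℤ.* A ℤ.- + 1) ≡
        (ρ ℤ.+ ι ℤ.- K) ℤ.* A ℤ.+ ι ℤ.* (+ 3 ℤ.* A ℤ.- + 1) ℤ.+ p ℤ.* (A ℤ.* (A ℤ.+ (+ 3 ℤ.* A ℤ.- + 1)))
      collect = ℤ.solve-∀

  combination-≤k : ∀ z → ∃ λ l → Combination N₀ a b z l × l ≤ k
  combination-≤k z with representation z
  ... | j , r , p , j≤n , r<a+b , z≡ with ≤-total (r + j) k
  -- The coefficient of `a` is `−m`, so the second sign pattern applies, with length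
  -- `m + j = k − r`.
  ... | inj₁ r+j≤k =
        let m , r+j+m≡k = m≤n⇒∃[o]m+o≡n r+j≤k in
        m + j ,
        (m , j , refl , inj₂ (inj₁ (congruent p (trans z≡ (eq (+ (r + j)) (+ m) (+ a) (+ j ℤ.* + b) _ (cong +_ r+j+m≡k)))))) ,
        subst (m + j ≤_) (trans (rearrange m j r) r+j+m≡k) (m≤m+n (m + j) r)
    where
    rearrange : ∀ m j r → m + j + r ≡ r + j + m
    rearrange = solve-∀
    eq : ∀ s μ A y w {K} → s ℤ.+ μ ≡ K →
         (s ℤ.- K) ℤ.* A ℤ.+ y ℤ.+ w ≡ ℤ.- (μ ℤ.* A) ℤ.+ y ℤ.+ w
    eq s μ A y w refl = identity s μ A y w
      where
      identity : ∀ s μ A y w → (s ℤ.- (s ℤ.+ μ)) ℤ.* A ℤ.+ y ℤ.+ w ≡ ℤ.- (μ ℤ.* A) ℤ.+ y ℤ.+ w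
      identity = ℤ.solve-∀
  ... | inj₂ k≤r+j with m≤n⇒∃[o]m+o≡n k≤r+j
  ... | m , k+m≡r+j with ≤-<-connex (m + j) k
  ... | inj₁ m+j≤k =
        m + j ,
        (m , j , refl , inj₁ (congruent p (trans z≡ (eq (+ k) (+ m) (+ a) (+ j ℤ.* + b) _ (cong +_ k+m≡r+j))))) ,
        m+j≤k
    where
    eq : ∀ K μ A y w {s} → K ℤ.+ μ ≡ s →
         (s ℤ.- K) ℤ.* A ℤ.+ y ℤ.+ w ≡ μ ℤ.* A ℤ.+ y ℤ.+ w
    eq K μ A y w refl = identity K μ A y w
      where
      identity : ∀ K μ A y w → (K ℤ.+ μ ℤ.- K) ℤ.* A ℤ.+ y ℤ.+ w ≡ μ ℤ.* A ℤ.+ y ℤ.+ w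
      identity = ℤ.solve-∀
  ... | inj₂ k<m+j with m≤n⇒∃[o]m+o≡n j≤n | m≤n⇒∃[o]m+o≡n a≤m
    where
    a≤m : a ≤ m
    -- `a + n = k < m + j ≤ m + n`.
    a≤m = +-cancelʳ-≤ n a m (≤-trans (≤-reflexive (eq n)) (≤-trans (<⇒≤ k<m+j) (+-monoʳ-≤ m j≤n)))
      where
      eq : ∀ n → n + 1 + n ≡ 2 * n + 1
      eq = solve-∀
  -- The relation a·a + a·b ≡ 0 trades (m, j) for (m − a, j − a).
  ... | c , j+c≡n | m′ , a+m′≡m =
        m′ + (c + 1) ,
        (m′ , c + 1 , refl , inj₂ (inj₂ (congruent (ℤ.suc p) (trans z≡
          (eq (+ k) (+ m′) (+ j) (+ c) (+ b) p N₀≡a[a+b]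
            (cong (λ i → + (i + 1)) (sym j+c≡n))
            (cong +_ (trans (sym k+m≡r+j) (cong (λ i → k + i) (sym a+m′≡m))))))))) ,
        bound
    where
    eq : ∀ K μ ι κ B p {A N s} → N ≡ A ℤ.* (A ℤ.+ B) → A ≡ ι ℤ.+ κ ℤ.+ + 1 → s ≡ K ℤ.+ (A ℤ.+ μ) →
         (s ℤ.- K) ℤ.* A ℤ.+ ι ℤ.* B ℤ.+ p ℤ.* N ≡
         μ ℤ.* A ℤ.- (κ ℤ.+ + 1) ℤ.* B ℤ.+ (+ 1 ℤ.+ p) ℤ.* N
    eq K μ ι κ B p refl refl refl = identity K μ ι κ B p
      where
      identity : ∀ K μ ι κ B p → let A = ι ℤ.+ κ ℤ.+ + 1 ; N = A ℤ.* (A ℤ.+ B) in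
        (K ℤ.+ (A ℤ.+ μ) ℤ.- K) ℤ.* A ℤ.+ ι ℤ.* B ℤ.+ p ℤ.* N ≡
        μ ℤ.* A ℤ.- (κ ℤ.+ + 1) ℤ.* B ℤ.+ (+ 1 ℤ.+ p) ℤ.* N
      identity = ℤ.solve-∀
    -- The length is `(m − a) + (a − j) = m − j = r − k`, which is at most `k` because
    -- `r < a + b = 2k + 1`. Adding `k + a` to both sides avoids subtraction.
    bound : m′ + (c + 1) ≤ k
    bound = +-cancelˡ-≤ (k + a) _ _ (begin
      k + a + (m′ + (c + 1))   ≡⟨ shuffle k a m′ c ⟩
      k + (a + m′) + (c + 1)   ≡⟨ cong (λ i → k + i + (c + 1)) a+m′≡m ⟩
      k + m + (c + 1)          ≡⟨ cong (_+ (c + 1)) k+m≡r+j ⟩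
      r + j + (c + 1)          ≡⟨ shift r j c ⟩
      suc r + (j + c)          ≡⟨ cong (λ i → suc r + i) j+c≡n ⟩
      suc r + n                ≤⟨ +-monoˡ-≤ n r<a+b ⟩
      a + b + n                ≡⟨ total n ⟩
      k + a + k                ∎)
      where
      open ≤-Reasoning
      shuffle : ∀ k a m c → k + a + (m + (c + 1)) ≡ k + (a + m) + (c + 1)
      shuffle = solve-∀
      shift : ∀ r j c → r + j + (c + 1) ≡ 1 + r + (j + c)
      shift = solve-∀
      total : ∀ n → n + 1 + (3 * n + 2) + n ≡ 2 * n + 1 + (n + 1) + (2 * n + 1)
      total = solve-∀

  -- Lower bound: the coset of (k, 0)

  lattice-coset : ∀ u v s → u ℤ.* + a ℤ.+ v ℤ.* + b ≡ + k ℤ.* + a ℤ.+ s ℤ.* + N₀ →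
    ∃ λ t → v ≡ t ℤ.* + a × u ≡ + k ℤ.+ s ℤ.* (+ a ℤ.+ + b) ℤ.- t ℤ.* + b
  lattice-coset u v s h = t , v≡ , u≡
    where
    -- Since `b = 3a − 1`, the left side of `h` is `(u + 3v) a − v`. Solving for `v` gives a
    -- multiple of `a`, with this cofactor.
    t = u ℤ.+ + 3 ℤ.* v ℤ.- + k ℤ.- s ℤ.* (+ a ℤ.+ + b)
    v≡ : v ≡ t ℤ.* + a
    v≡ = eq u v s (+ k) N₀≡a[a+b] b≡3a-1 h
      where
      eq : ∀ {A B N} u v s K → N ≡ A ℤ.* (A ℤ.+ B) → B ≡ + 3 ℤ.* A ℤ.- + 1 →
           u ℤ.* A ℤ.+ v ℤ.* B ≡ K ℤ.* A ℤ.+ s ℤ.* N →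
           v ≡ (u ℤ.+ + 3 ℤ.* v ℤ.- K ℤ.- s ℤ.* (A ℤ.+ B)) ℤ.* A
      eq {A} u v s K refl refl h =
        trans (expand A u v) (trans (cong (λ y → (u ℤ.+ + 3 ℤ.* v) ℤ.* A ℤ.- y) h) (collect A u v s K))
        where
        expand : ∀ A u v → v ≡ (u ℤ.+ + 3 ℤ.* v) ℤ.* A ℤ.- (u ℤ.* A ℤ.+ v ℤ.* (+ 3 ℤ.* A ℤ.- + 1))
        expand = ℤ.solve-∀
        collect : ∀ A u v s K → let D = A ℤ.+ (+ 3 ℤ.* A ℤ.- + 1) in
          (u ℤ.+ + 3 ℤ.* v) ℤ.* A ℤ.- (K ℤ.* A ℤ.+ s ℤ.* (A ℤ.* D)) ≡ (u ℤ.+ + 3 ℤ.* v ℤ.- K ℤ.- s ℤ.* D) ℤ.* A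
        collect = ℤ.solve-∀
    u≡ : u ≡ + k ℤ.+ s ℤ.* (+ a ℤ.+ + b) ℤ.- t ℤ.* + b
    u≡ = trans (expand u v (+ k ℤ.+ s ℤ.* (+ a ℤ.+ + b)))
           (trans (cong (λ y → + k ℤ.+ s ℤ.* (+ a ℤ.+ + b) ℤ.+ y ℤ.- + 3 ℤ.* v) (regroup u v (+ k) (s ℤ.* (+ a ℤ.+ + b))))
             (eq t v (+ k) (s ℤ.* (+ a ℤ.+ + b)) b≡3a-1 v≡))
      where
      expand : ∀ u v w → u ≡ w ℤ.+ (u ℤ.+ + 3 ℤ.* v ℤ.- w) ℤ.- + 3 ℤ.* v
      expand = ℤ.solve-∀
      regroup : ∀ u v K w → u ℤ.+ + 3 ℤ.* v ℤ.- (K ℤ.+ w) ≡ u ℤ.+ + 3 ℤ.* v ℤ.- K ℤ.- w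
      regroup = ℤ.solve-∀
      eq : ∀ {A B} t v K w → B ≡ + 3 ℤ.* A ℤ.- + 1 → v ≡ t ℤ.* A →
           K ℤ.+ w ℤ.+ t ℤ.- + 3 ℤ.* v ≡ K ℤ.+ w ℤ.- t ℤ.* B
      eq {A} t _ K w refl refl = identity A t K w
        where
        identity : ∀ A t K w →
          K ℤ.+ w ℤ.+ t ℤ.- + 3 ℤ.* (t ℤ.* A) ≡ K ℤ.+ w ℤ.- t ℤ.* (+ 3 ℤ.* A ℤ.- + 1)
        identity = ℤ.solve-∀

  n≤a : n ≤ a
  n≤a = m≤m+n n 1

  n≤b : n ≤ b
  n≤b = ≤-trans (m≤m+n n _) (m≤m+n (3 * n) 2)

  k≤2a : k ≤ a + a
  k≤2a = ≤-trans (n≤1+n k) (≤-reflexive (eq n))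
    where
    eq : ∀ n → 1 + (2 * n + 1) ≡ n + 1 + (n + 1)
    eq = solve-∀

  -- The row `t = 0`. Here `u` is congruent to `k` modulo `a + b = 2k + 1`, and the values nearest
  -- to zero are `k` and `−(k + 1) = −2a`.
  k≤∣u∣ : ∀ u s → u ≡ + k ℤ.+ s ℤ.* (+ a ℤ.+ + b) ℤ.- + 0 ℤ.* + b → k ≤ ∣ u ∣
  k≤∣u∣ u (+ s) u≡ = ≤∣⁺∣ k s (a + b) (trans u≡ (eq (+ b) (+ k ℤ.+ + s ℤ.* (+ a ℤ.+ + b))))
    where
    eq : ∀ B w → w ℤ.- + 0 ℤ.* B ≡ w
    eq = ℤ.solve-∀
  k≤∣u∣ u -[1+ s ] u≡ = ≤-trans k≤2a
    (≤∣⁻∣ (a + a) s (a + b) (trans u≡ (eq (+ s) {+ a} b≡3a-1 k≡2a-1)))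
    where
    eq : ∀ σ {A B K} → B ≡ + 3 ℤ.* A ℤ.- + 1 → K ≡ + 2 ℤ.* A ℤ.- + 1 →
         K ℤ.+ (ℤ.- (+ 1 ℤ.+ σ)) ℤ.* (A ℤ.+ B) ℤ.- + 0 ℤ.* B ≡ ℤ.- (A ℤ.+ A ℤ.+ σ ℤ.* (A ℤ.+ B))
    eq σ {A} refl refl = identity σ A
      where
      identity : ∀ σ A → let B = + 3 ℤ.* A ℤ.- + 1 ; K = + 2 ℤ.* A ℤ.- + 1 in
        K ℤ.+ (ℤ.- (+ 1 ℤ.+ σ)) ℤ.* (A ℤ.+ B) ℤ.- + 0 ℤ.* B ≡ ℤ.- (A ℤ.+ A ℤ.+ σ ℤ.* (A ℤ.+ B))
      identity = ℤ.solve-∀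

  -- The row `t = 1`, where `∣ v ∣` is `a` and only `k − a = n` is still required of `u`. As
  -- `k − b = −a`, the values nearest to zero are `−a` and `b`.
  n≤∣u∣⁺ : ∀ u s → u ≡ + k ℤ.+ s ℤ.* (+ a ℤ.+ + b) ℤ.- + 1 ℤ.* + b → n ≤ ∣ u ∣
  n≤∣u∣⁺ u s u≡ = cases s (trans u≡ (eq s {+ a} b≡3a-1 k≡2a-1))
    where
    eq : ∀ σ {A B K} → B ≡ + 3 ℤ.* A ℤ.- + 1 → K ≡ + 2 ℤ.* A ℤ.- + 1 →
         K ℤ.+ σ ℤ.* (A ℤ.+ B) ℤ.- + 1 ℤ.* B ≡ σ ℤ.* (A ℤ.+ B) ℤ.- A
    eq σ {A} refl refl = identity σ A
      where
      identity : ∀ σ A → let B = + 3 ℤ.* A ℤ.- + 1 ; K = + 2 ℤ.* A ℤ.- + 1 in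
        K ℤ.+ σ ℤ.* (A ℤ.+ B) ℤ.- + 1 ℤ.* B ≡ σ ℤ.* (A ℤ.+ B) ℤ.- A
      identity = ℤ.solve-∀
    cases : ∀ s → u ≡ s ℤ.* (+ a ℤ.+ + b) ℤ.- + a → n ≤ ∣ u ∣
    cases (+ 0) u≡ = ≤-trans n≤a (≤∣⁻∣ a 0 (a + b) (trans u≡ (zero-case (+ a) (+ b))))
      where
      zero-case : ∀ A B → + 0 ℤ.* (A ℤ.+ B) ℤ.- A ≡ ℤ.- (A ℤ.+ + 0 ℤ.* (A ℤ.+ B))
      zero-case = ℤ.solve-∀
    cases (+ suc s) u≡ = ≤-trans n≤b (≤∣⁺∣ b s (a + b) (trans u≡ (suc-case (+ s) (+ a) (+ b))))
      where
      suc-case : ∀ σ A B → (+ 1 ℤ.+ σ) ℤ.* (A ℤ.+ B) ℤ.- A ≡ B ℤ.+ σ ℤ.* (A ℤ.+ B)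
      suc-case = ℤ.solve-∀
    cases -[1+ s ] u≡ = ≤-trans n≤a (≤∣⁻∣ a (suc s) (a + b) (trans u≡ (neg-case (+ suc s) (+ a) (+ b))))
      where
      neg-case : ∀ σ A B → (ℤ.- σ) ℤ.* (A ℤ.+ B) ℤ.- A ≡ ℤ.- (A ℤ.+ σ ℤ.* (A ℤ.+ B))
      neg-case = ℤ.solve-∀

  -- The row `t = −1`, where again `∣ v ∣` is `a`. The value nearest to zero occurs at `s = −1` and
  -- is `k − a = n`, so the bound is attained. Its neighbours are `k + b` and `−3a`.
  n≤∣u∣⁻ : ∀ u s → u ≡ + k ℤ.+ s ℤ.* (+ a ℤ.+ + b) ℤ.- -[1+ 0 ] ℤ.* + b → n ≤ ∣ u ∣
  n≤∣u∣⁻ u (+ s) u≡ = ≤-trans n≤b (≤-trans (m≤n+m b k)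
    (≤∣⁺∣ (k + b) s (a + b) (trans u≡ (eq (+ k) (+ b) (+ s ℤ.* (+ a ℤ.+ + b))))))
    where
    eq : ∀ K B w → K ℤ.+ w ℤ.- (ℤ.- + 1) ℤ.* B ≡ K ℤ.+ B ℤ.+ w
    eq = ℤ.solve-∀
  n≤∣u∣⁻ u -[1+ 0 ] u≡ = ≤∣⁺∣ n 0 (a + b) (trans u≡ (eq (+ n) refl b≡3a-1 k≡2a-1))
    where
    eq : ∀ ν {A B K} → A ≡ ν ℤ.+ + 1 → B ≡ + 3 ℤ.* A ℤ.- + 1 → K ≡ + 2 ℤ.* A ℤ.- + 1 →
         K ℤ.+ (ℤ.- + 1) ℤ.* (A ℤ.+ B) ℤ.- (ℤ.- + 1) ℤ.* B ≡ ν ℤ.+ + 0 ℤ.* (A ℤ.+ B)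
    eq ν refl refl refl = identity ν
      where
      identity : ∀ ν → let A = ν ℤ.+ + 1 ; B = + 3 ℤ.* A ℤ.- + 1 ; K = + 2 ℤ.* A ℤ.- + 1 in
        K ℤ.+ (ℤ.- + 1) ℤ.* (A ℤ.+ B) ℤ.- (ℤ.- + 1) ℤ.* B ≡ ν ℤ.+ + 0 ℤ.* (A ℤ.+ B)
      identity = ℤ.solve-∀
  n≤∣u∣⁻ u -[1+ suc s ] u≡ = ≤-trans n≤a (≤-trans (m≤n+m a (a + a))
    (≤∣⁻∣ (a + a + a) s (a + b) (trans u≡ (eq (+ s) {+ a} b≡3a-1 k≡2a-1))))
    where
    eq : ∀ σ {A B K} → B ≡ + 3 ℤ.* A ℤ.- + 1 → K ≡ + 2 ℤ.* A ℤ.- + 1 →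
         K ℤ.+ (ℤ.- (+ 2 ℤ.+ σ)) ℤ.* (A ℤ.+ B) ℤ.- (ℤ.- + 1) ℤ.* B ≡
         ℤ.- (A ℤ.+ A ℤ.+ A ℤ.+ σ ℤ.* (A ℤ.+ B))
    eq σ {A} refl refl = identity σ A
      where
      identity : ∀ σ A → let B = + 3 ℤ.* A ℤ.- + 1 ; K = + 2 ℤ.* A ℤ.- + 1 in
        K ℤ.+ (ℤ.- (+ 2 ℤ.+ σ)) ℤ.* (A ℤ.+ B) ℤ.- (ℤ.- + 1) ℤ.* B ≡
        ℤ.- (A ℤ.+ A ℤ.+ A ℤ.+ σ ℤ.* (A ℤ.+ B))
      identity = ℤ.solve-∀

  n+a≡k : n + 1 * a ≡ k
  n+a≡k = eq n
    where
    eq : ∀ n → n + 1 * (n + 1) ≡ 2 * n + 1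
    eq = solve-∀

  k≤[2+t]a : ∀ t → k ≤ (2 + t) * a
  k≤[2+t]a t = ≤-trans k≤2a (+-monoʳ-≤ a (m≤m+n a (t * a)))

  -- By `lattice-coset`, `∣ v ∣` is `∣ t ∣ * a`. From `∣ t ∣ = 2` on this alone exceeds
  -- `k = 2a − 1`, which leaves the three rows treated above.
  k≤∣u∣+∣v∣ : ∀ u v s → u ℤ.* + a ℤ.+ v ℤ.* + b ≡ + k ℤ.* + a ℤ.+ s ℤ.* + N₀ → k ≤ ∣ u ∣ + ∣ v ∣
  k≤∣u∣+∣v∣ u v s h with lattice-coset u v s h
  ... | t , v≡ , u≡ = subst (λ i → k ≤ ∣ u ∣ + i) (sym (trans (cong ∣_∣ v≡) (ℤ.abs-* t (+ a)))) (cases t u≡)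
    where
    cases : ∀ t → u ≡ + k ℤ.+ s ℤ.* (+ a ℤ.+ + b) ℤ.- t ℤ.* + b → k ≤ ∣ u ∣ + ∣ t ∣ * a
    cases (+ 0)             u≡ = ≤-trans (k≤∣u∣ u s u≡) (m≤m+n ∣ u ∣ 0)
    cases (+ 1)             u≡ = subst (_≤ ∣ u ∣ + 1 * a) n+a≡k (+-monoˡ-≤ (1 * a) (n≤∣u∣⁺ u s u≡))
    cases (+ suc (suc t))   _  = ≤-trans (k≤[2+t]a t) (m≤n+m _ ∣ u ∣)
    cases -[1+ 0 ]          u≡ = subst (_≤ ∣ u ∣ + 1 * a) n+a≡k (+-monoˡ-≤ (1 * a) (n≤∣u∣⁻ u s u≡))
    cases -[1+ suc t ]      _  = ≤-trans (k≤[2+t]a t) (m≤n+m _ ∣ u ∣)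

  -- The diameter

  combination-ka : Combination N₀ a b (+ k ℤ.* + a) k
  combination-ka = k , 0 , +-identityʳ k , inj₁ (congruent (+ 0) (eq (+ k ℤ.* + a) (+ b) (+ N₀)))
    where
    eq : ∀ w B N → w ≡ w ℤ.+ + 0 ℤ.* B ℤ.+ + 0 ℤ.* N
    eq = ℤ.solve-∀

  combination-ka⇒≥k : ∀ l → Combination N₀ a b (+ k ℤ.* + a) l → k ≤ l
  combination-ka⇒≥k _ (m , n′ , refl , inj₁ c) with congruent⁻¹ {+ k ℤ.* + a} c
  ... | s , h = k≤∣u∣+∣v∣ (+ m) (+ n′) s h
  -- A minus sign in the pattern is absorbed into `u` here and into `v` in the next clause; absolute
  -- values do not see it.
  combination-ka⇒≥k _ (m , n′ , refl , inj₂ (inj₁ c)) with congruent⁻¹ {+ k ℤ.* + a} c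
  ... | s , h = subst (λ i → k ≤ i + n′) (ℤ.∣-i∣≡∣i∣ (+ m))
    (k≤∣u∣+∣v∣ (ℤ.- + m) (+ n′) s (trans (cong (ℤ._+ _) (sym (ℤ.neg-distribˡ-* (+ m) (+ a)))) h))
  combination-ka⇒≥k _ (m , n′ , refl , inj₂ (inj₂ c)) with congruent⁻¹ {+ k ℤ.* + a} c
  ... | s , h = subst (λ i → k ≤ m + i) (ℤ.∣-i∣≡∣i∣ (+ n′))
    (k≤∣u∣+∣v∣ (+ m) (ℤ.- + n′) s
      (trans (cong (λ y → + m ℤ.* + a ℤ.+ y) (sym (ℤ.neg-distribˡ-* (+ n′) (+ b)))) h))

  hasDiameter : HasDiameter (TQ N₀ a b isTQ) k
  hasDiameter = distance , x₀ , y₀ ,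
    subst (λ z → Combination N₀ a b z k) (sym z₀≡) combination-ka ,
    λ l c → combination-ka⇒≥k l (subst (λ z → Combination N₀ a b z l) z₀≡ c)
    where
    open ThreeQuartersDigraph (TQ N₀ a b isTQ) using (Vertex; rep; IsDistance)
    distance : ∀ x y → ∃ λ l → IsDistance x y l × l ≤ k
    distance x y =
      let z = rep y ℤ.- rep x
          l , c , l≤k = combination-≤k z
          d , isLeast , d≤l = least (combination? N₀ a b z) l c
      in d , isLeast , ≤-trans d≤l l≤k
    0<N₀ : 0 < N₀
    0<N₀ = ≤-trans (s≤s z≤n) (IsTQ.2≤N isTQ)
    -- Hence `k a` is its own representative, and the pair of vertices 0 and `k a` realises the
    -- distance `k`.
    ka<N₀ : k * a < N₀
    ka<N₀ = subst (k * a <_) (sym (eq n)) (m≤m+n (suc (k * a)) _)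
      where
      eq : ∀ n → 4 * (n * (n * 1)) + 7 * n + 3 ≡ 1 + (2 * n + 1) * (n + 1) + (2 * (n * n) + 4 * n + 1)
      eq = solve-∀
    x₀ y₀ : Vertex
    x₀ = fromℕ< 0<N₀
    y₀ = fromℕ< ka<N₀
    z₀≡ : rep y₀ ℤ.- rep x₀ ≡ + k ℤ.* + a
    z₀≡ = trans (cong₂ (λ i j → + i ℤ.- + j) (toℕ-fromℕ< ka<N₀) (toℕ-fromℕ< 0<N₀))
      (trans (ℤ.+-identityʳ (+ (k * a))) (ℤ.pos-* k a))

-- All odd diameters

odd : ∀ k → 1 < k → k % 2 ≡ 1 → ∃ λ n → 2 * n + 1 ≡ k
odd k 1<k k%2≡1 = k / 2 , sym (trans (m≡m%n+[m/n]*n k 2) (trans (cong (_+ k / 2 * 2) k%2≡1) (eq (k / 2))))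
  where
  eq : ∀ q → 1 + q * 2 ≡ 2 * q + 1
  eq = solve-∀

proposition2p2 : (∀ n → 1 ≤ n →
    let k  = 2 * n + 1
        N₀ = 4 * n ^ 2 + 7 * n + 3
        a  = n + 1
        b  = 3 * n + 2
    in (fromℕ N₀ ≃ order k)
    × (Σ[ valid ∈ IsTQ N₀ a b ] HasDiameter (TQ N₀ a b valid) k))
    × (∀ k → 1 < k → k % 2 ≡ 1 →
    ∃ λ T → HasDiameter T k × (fromℕ (N T) ≃ order k))
proposition2p2 =
    (λ n _ → let open Family n in N₀≃order , isTQ , hasDiameter)
  , λ k 1<k k%2≡1 → family k (odd k 1<k k%2≡1)
  where
  family : ∀ k → ∃ (λ n → 2 * n + 1 ≡ k) → ∃ λ T → HasDiameter T k × (fromℕ (N T) ≃ order k)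
  family _ (n , refl) = let open Family n in TQ N₀ a b isTQ , hasDiameter , N₀≃order
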